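{- There is a constant $K>0$ such that, for infinitely many positive integers $n$, there exists a ZDD $G$ with $n$ nodes whose corresponding top ZDD has at most $K\log n$ vertices. (That is, there exist ZDDs with $n$ nodes, $n\to\infty$, to which the corresponding top ZDD has $O(\log n)$ vertices.) Here the vertices of the top ZDD are the vertices of its top DAG $\mathcal{T}D$.
   Context: **ZDD.** Let $C=\{1,\dots,c\}$. An (ordered) ZDD is a finite directed acyclic graph $G$ with a root node from which all nodes are reachable. It has branching nodes and terminal nodes. The terminal nodes are $\bot$ and $\top$ and have no outgoing edges. Each branching node $v$ has a label $\ell(v)\in\{1,\dots,c\}$ and exactly two outgoing edges, a $0$-edge to $\mathit{zero}(v)$ and a $1$-edge to $\mathit{one}(v)$ (possibly with the same target). By convention $\ell(\bot)=\ell(\top)=c+1$, and $\ell(v)<\ell(\mathit{zero}(v))$, $\ell(v)<\ell(\mathit{one}(v))$ for all branching nodes $v$. The family represented by a node is $\mathcal{F}_\top=\{\emptyset\}$, $\mathcal{F}_\bot=\emptyset$, $\mathcal{F}_v=\{S\cup\{\ell(v)\}\mid S\in\mathcal{F}_{\mathit{one}(v)}\}\cup\mathcal{F}_{\mathit{zero}(v)}$; $G$ represents $\mathcal{F}_{\text{root}}$. Each edge $(u,v)$ carries as label the pair (type $0$ or $1$, $\ell(u)-\ell(v)$) if $v$ is branching, and (type $0$ or $1$, $\bot$ or $\top$) if $v$ is terminal. It is assumed that $G$ has at least two branching nodes. **Clusters and top trees.** Let $T$ be a rooted ordered tree with edges directed away from the root. A cluster is a connected set $F$ of nodes of $T$;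 its node closest to the root is its top boundary node. At most one node of $F$ has directed edges to nodes outside $F$; if there is such a node, it is the bottom boundary node. (A cluster carries a set of edges of $T$; for a cluster formed by horizontal merging of some of the child edges of its top boundary node, the other child edges of that top node are disregarded in this condition.) Two clusters can be merged (union) *vertically* if the top boundary node of one is the bottom boundary node of the other and no edges leave the common node to outside the two clusters; they can be merged *horizontally* if they have the same top boundary node and at least one of them has no bottom boundary node. A top tree $\mathcal{T}$ of $T$ is a binary tree whose leaves correspond to the single-edge clusters of $T$, whose internal vertices correspond to the merge of the clusters of their two children (for a vertical merge the left child is the upper cluster; for a horizontal merge the left child is the cluster coming first in the order of children), and whose root corresponds to all of $T$. A leaf of $\mathcal{T}$ is labeled by the label of its edge; an internal vertex is labeled $\mathrm{V}$ for a vertical merge, $\mathrm{H_L}$ (resp. $\mathrm{H_R}$) for a horizontal merge in which the left (resp. right) child has a bottom boundary node, and $\mathrm{H_L}$, say, if neither has. **Greedy construction of $\mathcal{T}$ (Bille et al.).** Maintain an ordered tree $\widetilde T$, initially $T$, each edge of which represents a cluster (initially single edges). Repeat rounds until $\widetilde T$ is a single edge. In each round, with respect to the tree $\widetilde T$ at the start of the round: (Step 1, horizontal) for each node $v$ with children $v_1,\dots,v_k$, $k\ge 2$, for $i=1,\dots,\lfloor k/2\rfloor$ merge the edges $(v,v_{2i-1})$ and $(v,v_{2i})$ if $v_{2i-1}$ or $v_{2i}$ is a leaf; if $k$ is odd, $v_k$ is a leaf and both $v_{k-2},v_{k-1}$ are non-leaves, also merge $(v,v_{k-1})$ and $(v,v_k)$.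 (Step 2, vertical) for each maximal path $v_1,\dots,v_p$ where $v_{i+1}$ is the parent of $v_i$ and $v_2,\dots,v_{p-1}$ have a single child: if $p$ is even merge the pairs of edges $\{(v_1,v_2),(v_2,v_3)\},\{(v_3,v_4),(v_4,v_5)\},\dots,\{(v_{p-3},v_{p-2}),(v_{p-2},v_{p-1})\}$; if $p$ is odd merge $\{(v_1,v_2),(v_2,v_3)\},\dots,\{(v_{p-4},v_{p-3}),(v_{p-3},v_{p-2})\}$ and, if $(v_{p-1},v_p)$ was not merged in Step 1, also $\{(v_{p-2},v_{p-1}),(v_{p-1},v_p)\}$. Each merge of two edges replaces them in $\widetilde T$ by one edge and creates a vertex of $\mathcal{T}$ whose children are the vertices of the two merged clusters. **The top ZDD of a ZDD $G$.** 1. A depth-first traversal from the root of $G$ (at each node the $0$-edge comes before the $1$-edge; both kinds of edges may become tree edges; terminals are not included) yields a spanning tree $T$ of the branching nodes. Nodes of $T$ are identified with their preorders (starting at $1$). Edges of $G$ not in $T$ are called complement edges. 2. $T$, as an edge-labeled tree, is converted to a top tree $\mathcal{T}$ by the greedy construction. 3. Each complement edge $(u,v)$ is stored in a vertex of $\mathcal{T}$. If $u$ is not the root of $T$, let $a$ be the leaf of $\mathcal{T}$ for the edge of $T$ from the parent of $u$ to $u$. If $v$ is a terminal, the triple ($(u,v)$, type $0$/$1$, $\bot$/$\top$) is stored in $a$. If $v$ is a branching node, let $b$ be the leaf of $\mathcal{T}$ for the edge of $T$ from the parent of $v$ to $v$; the triple ($(u,v)$, type $0$/$1$, $\ell(u)-\ell(v)$)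 is stored in $\mathrm{lca}(a,b)$ in $\mathcal{T}$. In these triples $u$ and (if branching) $v$ are given by their local preorders inside the cluster of the vertex in which the triple is stored. If $u$ is the root of $T$, the complement edge is stored in the root of $\mathcal{T}$. 4. The top DAG $\mathcal{T}D$ is obtained from $\mathcal{T}$ by DAG compression: two vertices of $\mathcal{T}$ are identified iff the subtrees of $\mathcal{T}$ rooted at them are identical as ordered labeled trees, including the complement-edge triples stored in their vertices. Complement edges which do not appear in multiple clusters (i.e. stored in a vertex of $\mathcal{T}D$ that arises from only one vertex of $\mathcal{T}$) are moved to the root. The top ZDD is $\mathcal{T}D$ together with the stored labels and complement edges. -}

module Defs where

open import Data.Bool.Base using (Bool; true; false; if_then_else_; _∨_)
open import Data.Fin.Base using (Fin)
import Data.Fin.Properties as Fin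
open import Data.Integer.Base using (ℤ; _⊖_)
import Data.Integer.Properties as ℤ
open import Data.List.Base
  using (List; []; _∷_; _++_; _∷ʳ_; map; concatMap; filter; takeWhile; deduplicate; length)
open import Data.List.Membership.Propositional using (_∈_; _∉_)
import Data.List.Membership.DecPropositional as DecMembership
import Data.List.Properties as List
open import Data.Nat.Base using (ℕ; suc; _+_; _≤_; _<_)
import Data.Nat.Properties as ℕ
open import Data.Product.Base using (_×_; _,_; proj₁; proj₂)
import Data.Product.Properties as Product
open import Data.Sum.Base using (_⊎_; inj₁; inj₂)
import Data.Sum.Properties as Sum
open import Relation.Binary.Construct.Closure.ReflexiveTransitive using (Star)
open import Relation.Binary.Definitions using (DecidableEquality)
open import Relation.Binary.PropositionalEquality using (_≡_; refl)
open import Relation.Nullary.Decidable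
  using (Dec; yes; no; does; ¬?; _×-dec_; _⊎-dec_)
open import Data.Empty using (⊥)

------------------------------------------------------------------------
-- ZDDs

data Kind : Set where
  0-edge 1-edge : Kind

data Terminal : Set where
  bot top : Terminal

data Node (m : ℕ) : Set where
  terminal : Terminal → Node m
  branch   : Fin m → Node m

level : ∀ {m} → ℕ → (Fin m → ℕ) → Node m → ℕ
level c ℓ (terminal _) = suc c
level c ℓ (branch v)   = ℓ v

data Step {m} (succ : Fin m → Kind → Node m) : Node m → Node m → Set where
  step : ∀ v k → Step succ (branch v) (succ v k)

-- Since there are branching nodes and terminals have no outgoing edges, the
-- root, from which all nodes are reachable, is a branching node.
record ZDD : Set where
  field
    c m  : ℕ
    ℓ    : Fin m → ℕ
    succ : Fin m → Kind → Node m
    root : Fin m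

    1≤ℓ       : ∀ v → 1 ≤ ℓ v
    ℓ≤c       : ∀ v → ℓ v ≤ c
    ordered   : ∀ v k → ℓ v < level c ℓ (succ v k)
    reachable : ∀ x → Star (Step succ) (branch root) x
    2≤m       : 2 ≤ m

  -- The branching nodes together with the two terminals.
  nodes : ℕ
  nodes = m + 2

------------------------------------------------------------------------
-- Ordered trees with labelled edges, and top trees

data Tree (E : Set) : Set where
  node : List (E × Tree E) → Tree E

module _ {E : Set} where

  isLeaf : Tree E → Bool
  isLeaf (node [])      = true
  isLeaf (node (_ ∷ _)) = false

  edges           : Tree E → List E
  edgesOfChildren : List (E × Tree E) → List E
  edges (node es) = edgesOfChildren es
  edgesOfChildren []             = []
  edgesOfChildren ((e , t) ∷ es) = e ∷ edges t ++ edgesOfChildren es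

module _ {E F : Set} (f : E → F) where

  mapTree     : Tree E → Tree F
  mapChildren : List (E × Tree E) → List (F × Tree F)
  mapTree (node es) = node (mapChildren es)
  mapChildren []             = []
  mapChildren ((e , t) ∷ es) = (f e , mapTree t) ∷ mapChildren es

data Merge : Set where
  V Hᴸ Hᴿ : Merge

data TopTree (E : Set) : Set where
  leaf  : E → TopTree E
  merge : Merge → TopTree E → TopTree E → TopTree E

leaves : ∀ {E} → TopTree E → List E
leaves (leaf e)      = e ∷ []
leaves (merge _ x y) = leaves x ++ leaves y

------------------------------------------------------------------------
-- The greedy construction

module Greedy {E : Set} where

  Cluster : Set
  Cluster = TopTree E

  -- During a round every edge carries a flag: was it created by a horizontal merge
  -- of this round?
  Flagged : Set
  Flagged = Bool × Cluster

  -- A cluster has a bottom boundary node iff the lower end of its edge is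
  -- not a leaf, so at most one of the two clusters merged here has one.
  mergeSiblings : Cluster × Tree Flagged → Cluster × Tree Flagged → Flagged × Tree Flagged
  mergeSiblings (x , s) (y , t) =
    if isLeaf t then ((true , merge Hᴸ x y) , s) else ((true , merge Hᴿ x y) , t)

  keep : Cluster × Tree Flagged → Flagged × Tree Flagged
  keep (x , t) = (false , x) , t

  -- 'unmatched' receives the second edge of a pair that was not merged; if
  -- exactly one edge follows, it is the last one of an odd number of edges.
  pairSiblings : List (Cluster × Tree Flagged) → List (Flagged × Tree Flagged)
  unmatched    : Cluster × Tree Flagged → List (Cluster × Tree Flagged) →
                 List (Flagged × Tree Flagged)
  pairSiblings []             = []
  pairSiblings (e ∷ [])       = keep e ∷ []
  pairSiblings (e₁ ∷ e₂ ∷ es) =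
    if isLeaf (proj₂ e₁) ∨ isLeaf (proj₂ e₂)
    then mergeSiblings e₁ e₂ ∷ pairSiblings es
    else keep e₁ ∷ unmatched e₂ es
  unmatched e₂ (e₃ ∷ []) =
    if isLeaf (proj₂ e₃)
    then mergeSiblings e₂ e₃ ∷ []
    else keep e₂ ∷ keep e₃ ∷ []
  unmatched e₂ es = keep e₂ ∷ pairSiblings es

  horizontal         : Tree Cluster → Tree Flagged
  horizontalChildren : List (Cluster × Tree Cluster) → List (Cluster × Tree Flagged)
  horizontal (node es) = node (pairSiblings (horizontalChildren es))
  horizontalChildren []             = []
  horizontalChildren ((x , t) ∷ es) = (x , horizontal t) ∷ horizontalChildren es

  -- 'climb b x t xs' merges the edges x ∷ xs of a maximal path v₁, …, vₚ,
  -- listed from the lowest one, (v₁,v₂), to the highest one, (vₚ₋₁,vₚ); t is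
  -- the tree below v₁ and b is the flag of the highest edge.
  climb : Bool → Cluster → Tree Cluster → List Cluster → Cluster × Tree Cluster
  climb b x t []           = x , t
  climb b x t (y ∷ [])     = if b then (y , node ((x , t) ∷ [])) else (merge V y x , t)
  climb b x t (y ∷ z ∷ zs) = climb b z (node ((merge V y x , t) ∷ [])) zs

  -- The paths are those of the tree before Step 1.  There a node has a single
  -- child iff it now has a single outgoing edge and this edge is unflagged: the
  -- number of edges leaving a node drops only by merges, which set the flag.
  vertical         : Tree Flagged → Tree Cluster
  verticalChildren : List (Flagged × Tree Flagged) → List (Cluster × Tree Cluster)
  path             : Bool → Cluster → List Cluster → Tree Flagged → Cluster × Tree Cluster
  vertical (node es) = node (verticalChildren es)
  verticalChildren []                   = []
  verticalChildren (((b , x) , t) ∷ es) = path b x [] t ∷ verticalChildren es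
  path b x xs (node (((false , y) , t) ∷ [])) = path b y (x ∷ xs) t
  path b x xs (node es)                       = climb b x (node (verticalChildren es)) xs

  round : Tree Cluster → Tree Cluster
  round t = vertical (horizontal t)

  -- A single edge is a fixed point of 'round', so the result is unique.
  data _⇓_ : Tree Cluster → Cluster → Set where
    done : ∀ {x} → node ((x , node []) ∷ []) ⇓ x
    next : ∀ {t x} → round t ⇓ x → t ⇓ x

open Greedy using (_⇓_)

------------------------------------------------------------------------
-- Vertices of the top DAG

-- The two ends of the edge, its kind, and ⊥/⊤ or the difference of the node
-- labels; nodes are given by local preorders.
Triple : Set
Triple = ℕ × Kind × (Terminal ⊎ (ℕ × ℤ))

data Labelled : Set where
  leaf  : Kind × ℤ → List Triple → Labelled
  merge : Merge → List Triple → Labelled → Labelled → Labelled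

triples : Labelled → List Triple
triples (leaf _ ts)      = ts
triples (merge _ ts _ _) = ts

_≟ᴷ_ : DecidableEquality Kind
0-edge ≟ᴷ 0-edge = yes refl
0-edge ≟ᴷ 1-edge = no λ ()
1-edge ≟ᴷ 0-edge = no λ ()
1-edge ≟ᴷ 1-edge = yes refl

_≟ᵀ_ : DecidableEquality Terminal
bot ≟ᵀ bot = yes refl
bot ≟ᵀ top = no λ ()
top ≟ᵀ bot = no λ ()
top ≟ᵀ top = yes refl

_≟ᴹ_ : DecidableEquality Merge
V  ≟ᴹ V  = yes refl
V  ≟ᴹ Hᴸ = no λ ()
V  ≟ᴹ Hᴿ = no λ ()
Hᴸ ≟ᴹ V  = no λ ()
Hᴸ ≟ᴹ Hᴸ = yes refl
Hᴸ ≟ᴹ Hᴿ = no λ ()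
Hᴿ ≟ᴹ V  = no λ ()
Hᴿ ≟ᴹ Hᴸ = no λ ()
Hᴿ ≟ᴹ Hᴿ = yes refl

_≟ᵗ_ : DecidableEquality Triple
_≟ᵗ_ = Product.≡-dec ℕ._≟_ (Product.≡-dec _≟ᴷ_ (Sum.≡-dec _≟ᵀ_ (Product.≡-dec ℕ._≟_ ℤ._≟_)))

_≟ᴸ_ : DecidableEquality Labelled
leaf l ts ≟ᴸ leaf l′ ts′
  with Product.≡-dec _≟ᴷ_ ℤ._≟_ l l′ | List.≡-dec _≟ᵗ_ ts ts′
... | yes refl | yes refl = yes refl
... | no l≢    | _        = no λ { refl → l≢ refl }
... | yes _    | no ts≢   = no λ { refl → ts≢ refl }
leaf _ _ ≟ᴸ merge _ _ _ _ = no λ ()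
merge _ _ _ _ ≟ᴸ leaf _ _ = no λ ()
merge k ts x y ≟ᴸ merge k′ ts′ x′ y′
  with k ≟ᴹ k′ | List.≡-dec _≟ᵗ_ ts ts′ | x ≟ᴸ x′ | y ≟ᴸ y′
... | yes refl | yes refl | yes refl | yes refl = yes refl
... | no k≢    | _        | _        | _        = no λ { refl → k≢ refl }
... | yes _    | no ts≢   | _        | _        = no λ { refl → ts≢ refl }
... | yes _    | yes _    | no x≢    | _        = no λ { refl → x≢ refl }
... | yes _    | yes _    | yes _    | no y≢    = no λ { refl → y≢ refl }

-- A vertex is the subtree of the labelled top tree, with the triples as stored
-- before any are moved to the root, that it arises from; its children are the
-- immediate subtrees.  'stored' gives the triples after the move.
record TopZDD : Set where
  field
    vertices : List Labelled
    root     : Labelled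
    stored   : Labelled → List Triple

  size : ℕ
  size = length vertices

------------------------------------------------------------------------
-- The top ZDD of a ZDD

module _ (G : ZDD) where
  open ZDD G
  open DecMembership (Fin._≟_ {m}) using (_∈?_)

  record Arc : Set where
    constructor arc
    field
      source : Fin m
      kind   : Kind
      target : Fin m

  open Arc

  -- 'DFS v s s′ t': visiting v, when the nodes visited so far are s (in order
  -- of their first visit), builds the tree t and ends with visited nodes s′.
  data DFS (v : Fin m) (s : List (Fin m)) : List (Fin m) → Tree Arc → Set
  data Follow (v : Fin m) (k : Kind) (s : List (Fin m)) :
              List (Fin m) → List (Arc × Tree Arc) → Set

  data DFS v s where
    visit : ∀ {s₀ s₁ es₀ es₁} →
            Follow v 0-edge (s ∷ʳ v) s₀ es₀ → Follow v 1-edge s₀ s₁ es₁ →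
            DFS v s s₁ (node (es₀ ++ es₁))

  data Follow v k s where
    to-terminal : ∀ {b} → succ v k ≡ terminal b → Follow v k s s []
    to-visited  : ∀ {w} → succ v k ≡ branch w → w ∈ s → Follow v k s s []
    to-new      : ∀ {w s′ t} → succ v k ≡ branch w → w ∉ s → DFS w s s′ t →
                  Follow v k s s′ ((arc v k w , t) ∷ [])

  -- The relations DFS and _⇓_ are deterministic, so T, its preorder and 𝒯 are
  -- determined by G.
  record Construction : Set where
    field
      preorder : List (Fin m)
      T        : Tree Arc
      dfs      : DFS root [] preorder T
      𝒯        : TopTree Arc
      greedy   : mapTree leaf T ⇓ 𝒯

  module _ (C : Construction) where
    open Construction C

    Edge : Set
    Edge = Fin m × Kind × Node m

    treeEdges : List (Fin m × Kind)
    treeEdges = map (λ a → source a , kind a) (edges T)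

    open DecMembership (Product.≡-dec (Fin._≟_ {m}) _≟ᴷ_) using ()
      renaming (_∈?_ to _∈ᴱ?_)

    -- Listed by the preorder of the source, 0-edges before 1-edges.  Every set
    -- of complement edges below is a sublist of this list, so that equal sets
    -- of triples are equal lists.
    complementEdges : List Edge
    complementEdges =
      filter (λ (u , k , _) → ¬? ((u , k) ∈ᴱ? treeEdges))
        (concatMap (λ u → (u , 0-edge , succ u 0-edge) ∷ (u , 1-edge , succ u 1-edge) ∷ [])
          preorder)

    -- The nodes u for which the leaf of the edge from the parent of u to u is
    -- below the given vertex.
    targets : TopTree Arc → List (Fin m)
    targets x = map target (leaves x)

    clusterNodes : TopTree Arc → List (Fin m)
    clusterNodes x = concatMap (λ a → source a ∷ target a ∷ []) (leaves x)

    localPreorder : TopTree Arc → Fin m → ℕ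
    localPreorder x v =
      1 + length (takeWhile (λ w → ¬? (w Fin.≟ v)) (filter (_∈? clusterNodes x) preorder))

    triple : TopTree Arc → Edge → Triple
    triple x (u , k , terminal b) = localPreorder x u , k , inj₁ b
    triple x (u , k , branch v)   =
      localPreorder x u , k , inj₂ (localPreorder x v , (ℓ u ⊖ ℓ v))

    -- Storage of the edges whose source is not the root of T; the root of T is
    -- not a target of an edge of T, so the condition never holds for it.  As
    -- u ≢ v, lca(a,b) is the vertex with a below one child and b below the other.
    StoredAt : TopTree Arc → Edge → Set
    StoredAt (leaf a)      (u , _ , terminal _) = target a ≡ u
    StoredAt (leaf _)      (_ , _ , branch _)   = ⊥
    StoredAt (merge _ _ _) (_ , _ , terminal _) = ⊥
    StoredAt (merge _ x y) (u , _ , branch v)   =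
      (u ∈ targets x × v ∈ targets y) ⊎ (u ∈ targets y × v ∈ targets x)

    storedAt? : ∀ x e → Dec (StoredAt x e)
    storedAt? (leaf a)      (u , _ , terminal _) = target a Fin.≟ u
    storedAt? (leaf _)      (_ , _ , branch _)   = no λ ()
    storedAt? (merge _ _ _) (_ , _ , terminal _) = no λ ()
    storedAt? (merge _ x y) (u , _ , branch v)   =
      ((u ∈? targets x) ×-dec (v ∈? targets y)) ⊎-dec ((u ∈? targets y) ×-dec (v ∈? targets x))

    data Position : Set where
      atRoot belowRoot : Position

    storedEdges : Position → TopTree Arc → List Edge
    storedEdges atRoot    x =
      filter (λ e → storedAt? x e ⊎-dec (proj₁ e Fin.≟ root)) complementEdges
    storedEdges belowRoot x = filter (storedAt? x) complementEdges

    labelled : Position → TopTree Arc → Labelled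
    labelled p x@(leaf (arc u k v)) = leaf (k , (ℓ u ⊖ ℓ v)) (map (triple x) (storedEdges p x))
    labelled p x@(merge h y z)      =
      merge h (map (triple x) (storedEdges p x)) (labelled belowRoot y) (labelled belowRoot z)

    subtrees : Position → TopTree Arc → List (Labelled × List Edge)
    subtrees p x@(leaf _)      = (labelled p x , storedEdges p x) ∷ []
    subtrees p x@(merge _ y z) =
      (labelled p x , storedEdges p x) ∷ subtrees belowRoot y ++ subtrees belowRoot z

    topTreeVertices : List (Labelled × List Edge)
    topTreeVertices = subtrees atRoot 𝒯

    multiplicity : Labelled → ℕ
    multiplicity x = length (filter (x ≟ᴸ_) (map proj₁ topTreeVertices))

    -- The edges moved to the root include those already stored there.
    movedToRoot : List Edge
    movedToRoot =
      concatMap (λ (x , es) → if does (multiplicity x ℕ.≟ 1) then es else []) topTreeVertices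

    topZDD : TopZDD
    topZDD = record
      { vertices = deduplicate _≟ᴸ_ (map proj₁ topTreeVertices)
      ; root     = labelled atRoot 𝒯
      ; stored   = λ x →
          if does (x ≟ᴸ labelled atRoot 𝒯) then map (triple 𝒯) movedToRoot
          else if does (multiplicity x ℕ.≟ 1) then []
          else triples x
      }

{-# OPTIONS --safe #-}

-- The witnesses are paths: every 0-edge leads to ⊥ and every 1-edge to the next
-- node, so the spanning tree is a path of M = 2ᵏ edges and the greedy
-- construction yields the complete binary tree of height k.  All complement
-- edges end in terminals, so, except at the root, they are stored in leaves.
-- Hence at each height all the subtrees have the same labels, save the last one
-- (its lowest node has a 1-edge to ⊤), and at most 2k + 1 vertices remain.
module Submission where

open import Defs
open import Data.Bool.Base using (false; if_then_else_)
open import Data.Fin.Base using (Fin; toℕ; fromℕ<)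
import Data.Fin.Properties as Fin
open import Data.Integer.Base using (-[1+_]; _⊖_)
import Data.Integer.Properties as ℤ
open import Data.List.Base
  using (List; []; _∷_; _++_; _∷ʳ_; _ʳ++_; map; concatMap; deduplicate; filter; length; takeWhile)
import Data.List.Membership.DecPropositional as DecMembership
open import Data.List.Membership.Propositional using (_∈_; _∉_)
open import Data.List.Membership.Propositional.Properties
  using (∈-++⁺ˡ; ∈-++⁺ʳ; ∈-++⁻; ∈-∃++; ∈-deduplicate⁻; ∈-filter⁻; ∈-map⁺)
open import Data.List.Properties
  using ( ++-assoc; ++-identityʳ; concatMap-++; filter-++; filter-accept; filter-all; filter-none
        ; length-++; map-++)
open import Data.List.Relation.Unary.All as All using (All; []; _∷_)
import Data.List.Relation.Unary.All.Properties as All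
open import Data.List.Relation.Unary.AllPairs using ([]; _∷_)
open import Data.List.Relation.Unary.Any using (here; there)
open import Data.List.Relation.Unary.Unique.DecPropositional.Properties using (deduplicate-!)
open import Data.List.Relation.Unary.Unique.Propositional using (Unique)
open import Data.Nat.Base using (ℕ; zero; suc; _+_; _*_; _^_; _∸_; _⊓_; _<_; _≤_; z≤n; s≤s; s≤s⁻¹; z<s)
open import Data.Nat.Logarithm using (⌊log₂_⌋; ⌊log₂⌋-mono-≤; ⌊log₂[2^n]⌋≡n)
open import Data.Nat.Properties
  using ( _<?_; ≤-refl; ≤-reflexive; ≤-trans; <-trans; <-irrefl; <⇒≤; n<1+n; n≤1+n; m≤m+n; m≤n+m
        ; m⊓n≤n; m≤n⇒m⊓n≡m; m≤n⇒m<n∨m≡n; m+[n∸m]≡n; +-suc; +-identityʳ; +-mono-≤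
        ; *-comm; *-assoc; *-suc; *-identityʳ; *-monoˡ-≤; *-monoʳ-≤; m^n>0; module ≤-Reasoning)
open import Data.Product.Base using (_×_; _,_; ∃-syntax; proj₁; proj₂)
import Data.Product.Properties as Product
open import Data.Sum.Base using (inj₁; inj₂)
open import Function.Base using (_∘_)
open import Relation.Binary.Construct.Closure.ReflexiveTransitive using (Star; ε; _◅_; _◅◅_)
open import Relation.Binary.Definitions using (DecidableEquality)
open import Relation.Binary.PropositionalEquality
  using (_≡_; _≢_; refl; sym; trans; cong; cong₂; subst; subst₂; module ≡-Reasoning)
open import Relation.Nullary.Decidable using (Dec; yes; no; does; ¬?; dec-true; dec-false)
open import Relation.Nullary.Negation using (¬_; contradiction)
open import Relation.Unary using (Decidable)

-- Counting and filtering in lists.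

module _ {A : Set} where

  -- Pigeonhole: delete one occurrence of the head `x` from `ys`. The tail of `xs` avoids `x` by
  -- uniqueness, so it still lies in the shortened list.
  length-unique-≤ : ∀ {xs ys : List A} → Unique xs → All (_∈ ys) xs → length xs ≤ length ys
  length-unique-≤ [] [] = z≤n
  length-unique-≤ {x ∷ xs} (x∉xs ∷ !xs) (x∈ys ∷ xs⊆ys) with as , bs , refl ← ∈-∃++ x∈ys = begin
    suc (length xs)             ≤⟨ s≤s (length-unique-≤ !xs (All.zipWith remove (x∉xs , xs⊆ys))) ⟩
    suc (length (as ++ bs))     ≡⟨ cong suc (length-++ as) ⟩
    suc (length as + length bs) ≡⟨ +-suc (length as) (length bs) ⟨
    length as + suc (length bs) ≡⟨ length-++ as ⟨
    length (as ++ x ∷ bs)       ∎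
    where
    open ≤-Reasoning
    remove : ∀ {y} → x ≢ y × y ∈ as ++ x ∷ bs → y ∈ as ++ bs
    remove (x≢y , y∈) with ∈-++⁻ as y∈
    ... | inj₁ y∈as         = ∈-++⁺ˡ y∈as
    ... | inj₂ (here y≡x)   = contradiction (sym y≡x) x≢y
    ... | inj₂ (there y∈bs) = ∈-++⁺ʳ as y∈bs

  length-deduplicate-≤ : ∀ (_≟_ : DecidableEquality A) {xs ys} →
                         All (_∈ ys) xs → length (deduplicate _≟_ xs) ≤ length ys
  length-deduplicate-≤ _≟_ {xs} xs⊆ys = length-unique-≤ (deduplicate-! _≟_ xs)
    (All.tabulate λ z∈ → All.lookup xs⊆ys (∈-deduplicate⁻ _≟_ xs z∈))

  ∈-weaken₂ : ∀ {x y : A} {xs ys} → All (_∈ ys) xs → All (_∈ x ∷ y ∷ ys) xs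
  ∈-weaken₂ = All.map (there ∘ there)

  All-map-++⁺ : ∀ {B : Set} {P : A → Set} {f : B → A} xs {ys} →
                All P (map f xs) → All P (map f ys) → All P (map f (xs ++ ys))
  All-map-++⁺ {P = P} {f} xs {ys} pxs pys = subst (All P) (sym (map-++ f xs ys)) (All.++⁺ pxs pys)

  filter-infix : ∀ {P : A → Set} (P? : Decidable P) {xs} ys {zs} →
                 All (¬_ ∘ P) xs → All (¬_ ∘ P) zs → filter P? (xs ++ ys ++ zs) ≡ filter P? ys
  filter-infix P? {xs} ys {zs} ¬xs ¬zs = begin
    filter P? (xs ++ ys ++ zs)                       ≡⟨ filter-++ P? xs (ys ++ zs) ⟩
    filter P? xs ++ filter P? (ys ++ zs)             ≡⟨ cong₂ _++_ (filter-none P? ¬xs) (filter-++ P? ys zs) ⟩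
    filter P? ys ++ filter P? zs                     ≡⟨ cong (filter P? ys ++_) (filter-none P? ¬zs) ⟩
    filter P? ys ++ []                               ≡⟨ ++-identityʳ _ ⟩
    filter P? ys                                     ∎
    where open ≡-Reasoning

  -- Here `P` is "stored at a given leaf" and `Q` is "complement edge". Since `P` alone rules out
  -- the other entries, `Q` has to be settled only at `y`.
  filter-filter-singleton : ∀ {P Q : A → Set} (P? : Decidable P) (Q? : Decidable Q) xs {y zs} →
    P y → Q y → All (¬_ ∘ P) xs → All (¬_ ∘ P) zs → filter P? (filter Q? (xs ++ y ∷ zs)) ≡ y ∷ []
  filter-filter-singleton P? Q? xs {y} {zs} py qy ¬xs ¬zs = begin
    filter P? (filter Q? (xs ++ y ∷ zs))             ≡⟨ cong (filter P?) (filter-++ Q? xs (y ∷ zs)) ⟩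
    filter P? (filter Q? xs ++ filter Q? (y ∷ zs))
      ≡⟨ cong (λ ys → filter P? (filter Q? xs ++ ys)) (filter-accept Q? qy) ⟩
    filter P? (filter Q? xs ++ y ∷ filter Q? zs)
      ≡⟨ filter-infix P? (y ∷ []) (All.filter⁺ Q? ¬xs) (All.filter⁺ Q? ¬zs) ⟩
    filter P? (y ∷ [])                               ≡⟨ filter-accept P? py ⟩
    y ∷ []                                           ∎
    where open ≡-Reasoning

open Greedy using (_⇓_)

-- The greedy construction on paths

module _ {E : Set} where

  chain : List E → Tree E
  chain []       = node []
  chain (x ∷ xs) = node ((x , chain xs) ∷ [])

  edges-chain : ∀ xs → edges (chain xs) ≡ xs
  edges-chain []       = refl
  edges-chain (x ∷ xs) = cong (x ∷_) (trans (++-identityʳ _) (edges-chain xs))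

module _ {E : Set} where
  open Greedy {E} hiding (_⇓_)

  unmerged : List Cluster → Tree Flagged
  unmerged xs = chain (map (false ,_) xs)

  horizontal-chain : ∀ xs → horizontal (chain xs) ≡ unmerged xs
  horizontal-chain []       = refl
  horizontal-chain (x ∷ xs) = cong (λ t → node (((false , x) , t) ∷ [])) (horizontal-chain xs)

  -- Edges are listed from the lowest one upwards. The empty list is allowed so that what remains
  -- after a merge has the same form as what came before.
  climbAll : List Cluster → Tree Cluster → Tree Cluster
  climbAll []       t = t
  climbAll (x ∷ xs) t = node (climb false x t xs ∷ [])

  -- A chain with all flags `false` is one maximal path: `path` descends to its end, accumulating
  -- the edges in reverse order.
  path-unmerged : ∀ x ys xs → node (path false x ys (unmerged xs) ∷ []) ≡ climbAll (xs ʳ++ x ∷ ys) (node [])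
  path-unmerged x ys []       = refl
  path-unmerged x ys (y ∷ xs) = path-unmerged y (x ∷ ys) xs

  round-chain : ∀ xs → round (chain xs) ≡ climbAll (xs ʳ++ []) (node [])
  round-chain xs rewrite horizontal-chain xs with xs
  ... | []     = refl
  ... | y ∷ ys = path-unmerged y [] ys

  -- The two lowest edges become one edge on top of the finished part `t`. With the flag `false`,
  -- this also holds when they are the last two edges of the path.
  climbAll-pair : ∀ x y zs t →
                  climbAll (y ∷ x ∷ zs) t ≡ climbAll zs (node ((merge V x y , t) ∷ []))
  climbAll-pair x y []       t = refl
  climbAll-pair x y (z ∷ zs) t = refl

  module _ (f : ℕ → E) where

    -- The b-th block of 2ʰ consecutive edges.
    block : ℕ → ℕ → Cluster
    block zero    b = leaf (f b)
    block (suc h) b = merge V (block h (b * 2)) (block h (suc (b * 2)))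

    blocks : ℕ → ℕ → ℕ → List Cluster
    blocks h b zero    = []
    blocks h b (suc n) = block h b ∷ blocks h (suc b) n

    -- Merging starts at the bottom, whereas `blocks` is listed from the top. So the induction moves
    -- the two topmost blocks onto `zs` and merges them after all the others. With the factor 2 on
    -- the right, `suc n * 2` unfolds to two more edges.
    climbAll-blocks : ∀ h b n zs → climbAll (blocks h (b * 2) (n * 2) ʳ++ zs) (node []) ≡
                      climbAll zs (chain (blocks (suc h) b n))
    climbAll-blocks h b zero    zs = refl
    climbAll-blocks h b (suc n) zs = trans
      (climbAll-blocks h (suc b) n (block h (suc (b * 2)) ∷ block h (b * 2) ∷ zs))
      (climbAll-pair (block h (b * 2)) (block h (suc (b * 2))) zs _)

    round-blocks : ∀ h n → round (chain (blocks h 0 (n * 2))) ≡ chain (blocks (suc h) 0 n)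
    round-blocks h n = trans (round-chain (blocks h 0 (n * 2))) (climbAll-blocks h 0 n [])

    -- Each round halves the number of edges and raises the height of the blocks by one, so a single
    -- edge is left after `j` rounds.
    blocks-⇓ : ∀ h j → chain (blocks h 0 (2 ^ j)) ⇓ block (j + h) 0
    blocks-⇓ h zero    = done
    blocks-⇓ h (suc j) = next (subst₂ _⇓_
      (sym (trans (cong (λ n → round (chain (blocks h 0 n))) (*-comm 2 (2 ^ j))) (round-blocks h (2 ^ j))))
      (cong (λ i → block i 0) (+-suc j h))
      (blocks-⇓ (suc h) j))

-- The path ZDD with M + 1 branching nodes.

module PathZDD (M : ℕ) (1≤M : 1 ≤ M) where

  open DecMembership (Fin._≟_ {suc M}) using (_∈?_)
  open DecMembership (Product.≡-dec (Fin._≟_ {suc M}) _≟ᴷ_) using () renaming (_∈?_ to _∈ᴱ?_)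

  -- Truncation at `M` makes this total, so that lists of nodes can be written without bounds.
  -- Arguments beyond `M` all give the last node.
  nd : ℕ → Fin (suc M)
  nd i = fromℕ< (s≤s (m⊓n≤n i M))

  toℕ-nd : ∀ {i} → i ≤ M → toℕ (nd i) ≡ i
  toℕ-nd i≤M = trans (Fin.toℕ-fromℕ< _) (m≤n⇒m⊓n≡m i≤M)

  nd-toℕ : ∀ v → nd (toℕ v) ≡ v
  nd-toℕ v = Fin.toℕ-injective (toℕ-nd (Fin.toℕ≤pred[n] v))

  next : Fin (suc M) → Node (suc M)
  next v = if does (toℕ v <? M) then branch (nd (suc (toℕ v))) else terminal top

  next-< : ∀ v → toℕ v < M → next v ≡ branch (nd (suc (toℕ v)))
  next-< v v<M = cong (λ b → if b then branch (nd (suc (toℕ v))) else terminal top) (dec-true (toℕ v <? M) v<M)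

  next-≮ : ∀ v → ¬ toℕ v < M → next v ≡ terminal top
  next-≮ v v≮M = cong (λ b → if b then branch (nd (suc (toℕ v))) else terminal top) (dec-false (toℕ v <? M) v≮M)

  next-nd : ∀ {i} → i < M → next (nd i) ≡ branch (nd (suc i))
  next-nd {i} i<M = trans (next-< (nd i) (subst (_< M) (sym eq) i<M)) (cong (branch ∘ nd ∘ suc) eq)
    where eq = toℕ-nd (<⇒≤ i<M)

  next-last : next (nd M) ≡ terminal top
  next-last = next-≮ (nd M) (<-irrefl (toℕ-nd ≤-refl))

  ℓ : Fin (suc M) → ℕ
  ℓ v = suc (toℕ v)

  succ : Fin (suc M) → Kind → Node (suc M)
  succ v 0-edge = terminal bot
  succ v 1-edge = next v

  succ-ordered : ∀ v k → ℓ v < level (suc M) ℓ (succ v k)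
  succ-ordered v 0-edge = s≤s (Fin.toℕ<n v)
  succ-ordered v 1-edge = by-cases (toℕ v <? M)
    where
    by-cases : Dec (toℕ v < M) → ℓ v < level (suc M) ℓ (next v)
    by-cases (yes v<M) rewrite next-< v v<M = s≤s (≤-reflexive (sym (toℕ-nd v<M)))
    by-cases (no  v≮M) rewrite next-≮ v v≮M = s≤s (Fin.toℕ<n v)

  reachable-nd : ∀ i → i ≤ M → Star (Step succ) (branch (nd 0)) (branch (nd i))
  reachable-nd zero    _   = ε
  reachable-nd (suc i) i<M =
    reachable-nd i (<⇒≤ i<M) ◅◅ subst (Step succ _) (next-nd i<M) (step (nd i) 1-edge) ◅ ε

  succ-reachable : ∀ x → Star (Step succ) (branch (nd 0)) x
  succ-reachable (terminal bot) = step (nd 0) 0-edge ◅ ε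
  succ-reachable (terminal top) =
    reachable-nd M ≤-refl ◅◅ subst (Step succ _) next-last (step (nd M) 1-edge) ◅ ε
  succ-reachable (branch v)     = subst (Star _ _ ∘ branch) (nd-toℕ v)
    (reachable-nd (toℕ v) (Fin.toℕ≤pred[n] v))

  G : ZDD
  G = record
    { c         = suc M
    ; m         = suc M
    ; ℓ         = ℓ
    ; succ      = succ
    ; root      = nd 0
    ; 1≤ℓ       = λ _ → s≤s z≤n
    ; ℓ≤c       = Fin.toℕ<n
    ; ordered   = succ-ordered
    ; reachable = succ-reachable
    ; 2≤m       = s≤s 1≤M
    }

  -- Depth-first traversal of the path.

  nds : ℕ → ℕ → List (Fin (suc M))
  nds a zero    = []
  nds a (suc n) = nd a ∷ nds (suc a) n

  nds-++ : ∀ a m n → nds a (m + n) ≡ nds a m ++ nds (a + m) n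
  nds-++ a zero    n = cong (λ b → nds b n) (sym (+-identityʳ a))
  nds-++ a (suc m) n = cong (nd a ∷_)
    (trans (nds-++ (suc a) m n) (cong (λ b → nds (suc a) m ++ nds b n) (sym (+-suc a m))))

  nds-≥ : ∀ a n → a + n ≤ suc M → All (λ v → a ≤ toℕ v) (nds a n)
  nds-≥ a zero    _   = []
  nds-≥ a (suc n) a+n≤M rewrite +-suc a n =
    ≤-reflexive (sym (toℕ-nd (≤-trans (m≤m+n a n) (s≤s⁻¹ a+n≤M)))) ∷
    All.map <⇒≤ (nds-≥ (suc a) n a+n≤M)

  nds-< : ∀ a n → a + n ≤ suc M → All (λ v → toℕ v < a + n) (nds a n)
  nds-< a zero    _   = []
  nds-< a (suc n) a+n≤M rewrite +-suc a n =
    s≤s (≤-trans (≤-reflexive (toℕ-nd (≤-trans (m≤m+n a n) (s≤s⁻¹ a+n≤M)))) (m≤m+n a n)) ∷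
    nds-< (suc a) n a+n≤M

  -- A block of height `suc h` consists of two blocks of height `h`, so going down one level doubles
  -- the number of blocks.
  halve : ∀ R h → R * 2 ^ suc h ≡ M → R * 2 * 2 ^ h ≡ M
  halve R h = trans (*-assoc R 2 (2 ^ h))

  arcAt : ℕ → Arc G
  arcAt i = arc (nd i) 1-edge (nd (suc i))

  arcs : ℕ → ℕ → List (Arc G)
  arcs a zero    = []
  arcs a (suc n) = arcAt a ∷ arcs (suc a) n

  ∈-arcs : ∀ a n {i} → a ≤ i → i < a + n → arcAt i ∈ arcs a n
  ∈-arcs a zero    a≤i i<a+n = contradiction
    (≤-trans i<a+n (≤-trans (≤-reflexive (+-identityʳ a)) a≤i)) (<-irrefl refl)
  ∈-arcs a (suc n) {i} a≤i i<a+n with m≤n⇒m<n∨m≡n a≤i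
  ... | inj₁ a<i  = there (∈-arcs (suc a) n a<i (subst (i <_) (+-suc a n) i<a+n))
  ... | inj₂ refl = here refl

  mapTree-arcs : ∀ a n → mapTree leaf (chain (arcs a n)) ≡ chain (blocks arcAt 0 a n)
  mapTree-arcs a zero    = refl
  mapTree-arcs a (suc n) = cong (λ t → node ((leaf (arcAt a) , t) ∷ [])) (mapTree-arcs (suc a) n)

  -- The invariant is that all visited nodes have index below `i`, hence the next node is always
  -- new. 0-edges end in ⊥ and add nothing to the tree; at `r = 0` the node is the last one and its
  -- 1-edge ends in ⊤.
  dfs-nd : ∀ i r {s} → i + r ≡ M → All (λ v → toℕ v < i) s →
           DFS G (nd i) s (s ++ nds i (suc r)) (chain (arcs i r))
  dfs-nd i zero    i≡M s<i rewrite trans (sym (+-identityʳ i)) i≡M =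
    visit (to-terminal refl) (to-terminal next-last)
  dfs-nd i (suc r) {s} i+r≡M s<i = visit (to-terminal refl) (to-new (next-nd i<M) fresh
    (subst (λ s′ → DFS G (nd (suc i)) (s ∷ʳ nd i) s′ (chain (arcs (suc i) r)))
      (++-assoc s (nd i ∷ []) _)
      (dfs-nd (suc i) r i+r≡M′ s<1+i)))
    where
    i+r≡M′ = trans (sym (+-suc i r)) i+r≡M
    i<M : i < M
    i<M = subst (suc i ≤_) i+r≡M′ (m≤m+n (suc i) r)
    s<1+i : All (λ v → toℕ v < suc i) (s ∷ʳ nd i)
    s<1+i = All.++⁺ (All.map (λ v<i → <-trans v<i (n<1+n i)) s<i)
      (s≤s (≤-reflexive (toℕ-nd (<⇒≤ i<M))) ∷ [])
    fresh : nd (suc i) ∉ s ∷ʳ nd i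
    fresh = All.All¬⇒¬Any (All.map (λ v<1+i eq → <-irrefl (trans (cong toℕ (sym eq)) (toℕ-nd i<M)) v<1+i) s<1+i)

  -- Complement edges and their storage.

  module _ (𝒯 : TopTree (Arc G)) (greedy : mapTree leaf (chain (arcs 0 M)) ⇓ 𝒯) where

    -- The top tree stays abstract here: the labels of vertices below the root depend only on the
    -- spanning tree, its preorder and the cluster itself.
    C : Construction G
    C = record
      { preorder = nds 0 (suc M)
      ; T        = chain (arcs 0 M)
      ; dfs      = dfs-nd 0 M refl []
      ; 𝒯        = 𝒯
      ; greedy   = greedy
      }

    outEdges : Fin (suc M) → List (Edge G C)
    outEdges u = (u , 0-edge , succ u 0-edge) ∷ (u , 1-edge , succ u 1-edge) ∷ []

    IsComplement : Edge G C → Set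
    IsComplement (u , k , _) = (u , k) ∉ treeEdges G C

    isComplement? : Decidable IsComplement
    isComplement? (u , k , _) = ¬? ((u , k) ∈ᴱ? treeEdges G C)

    treeEdge-< : ∀ {v} → toℕ v < M → (v , 1-edge) ∈ treeEdges G C
    treeEdge-< {v} v<M = subst₂ (λ u as → (u , 1-edge) ∈ map (λ a → Arc.source a , Arc.kind a) as)
      (nd-toℕ v) (sym (edges-chain (arcs 0 M)))
      (∈-map⁺ (λ a → Arc.source a , Arc.kind a) (∈-arcs 0 M z≤n v<M))

    treeEdges-1 : All (λ e → proj₂ e ≡ 1-edge) (treeEdges G C)
    treeEdges-1 rewrite edges-chain (arcs 0 M) = All.map⁺ (go 0 M)
      where
      go : ∀ a n → All (λ b → Arc.kind b ≡ 1-edge) (arcs a n)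
      go a zero    = []
      go a (suc n) = refl ∷ go (suc a) n

    0-edge-complement : ∀ u → (u , 0-edge) ∉ treeEdges G C
    0-edge-complement u e∈ with () ← All.lookup treeEdges-1 e∈

    HasTerminalTarget : Edge G C → Set
    HasTerminalTarget (_ , _ , x) = ∃[ b ] x ≡ terminal b

    -- A 0-edge ends in ⊥. A 1-edge leaving any node but the last is a tree edge, and that of the
    -- last node ends in ⊤.
    complementEdges-terminal : All HasTerminalTarget (complementEdges G C)
    complementEdges-terminal = All.tabulate λ e∈ →
      let e∈′ , c = ∈-filter⁻ isComplement? {xs = concatMap outEdges (nds 0 (suc M))} e∈ in
      All.lookup (All.concat⁺ (All.map⁺ {f = outEdges} (All.universal out (nds 0 (suc M))))) e∈′ c
      where
      out : ∀ u → All (λ e → IsComplement e → HasTerminalTarget e) (outEdges u)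
      out u = (λ _ → bot , refl) ∷
              (λ c → top , next-≮ u (c ∘ treeEdge-<)) ∷ []

    -- A merge vertex below the root stores only edges between branching nodes, and no complement
    -- edge is of this kind.
    storedEdges-merge : ∀ h x y → storedEdges G C belowRoot (merge h x y) ≡ []
    storedEdges-merge h x y = filter-none (storedAt? G C (merge h x y))
      (All.map (λ { (_ , refl) () }) complementEdges-terminal)

    -- Leaves whose edge does not end in the last node.

    module _ {i} (1+i<M : suc i < M) where

      private
        u = nd i
        v = nd (suc i)

        x : TopTree (Arc G)
        x = leaf (arcAt i)

        rest : ℕ
        rest = M ∸ suc i

        1+i+rest≡M : suc i + rest ≡ M
        1+i+rest≡M = m+[n∸m]≡n (<⇒≤ 1+i<M)

        1+i+1+rest≡1+M : suc i + suc rest ≡ suc M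
        1+i+1+rest≡1+M = trans (+-suc (suc i) rest) (cong suc 1+i+rest≡M)

        after : List (Fin (suc M))
        after = nds (suc (suc i)) rest

        toℕ-u : toℕ u ≡ i
        toℕ-u = toℕ-nd (<⇒≤ (<-trans (n<1+n i) 1+i<M))

        toℕ-v : toℕ v ≡ suc i
        toℕ-v = toℕ-nd (<⇒≤ 1+i<M)

        u≢v : u ≢ v
        u≢v u≡v = <-irrefl (trans (sym toℕ-u) (trans (cong toℕ u≡v) toℕ-v)) (n<1+n i)

        i≤1+M : i ≤ suc M
        i≤1+M = ≤-trans (<⇒≤ (<⇒≤ 1+i<M)) (n≤1+n M)

        <i⇒≢ : ∀ {w} → toℕ w < i → w ≢ u × w ≢ v
        <i⇒≢ w<i = (λ { refl → <-irrefl toℕ-u w<i })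
                 , (λ { refl → <-irrefl toℕ-v (<-trans w<i (n<1+n i)) })

        <1+i⇒≢ : ∀ {w} → toℕ w < suc i → w ≢ v
        <1+i⇒≢ w<1+i refl = <-irrefl toℕ-v w<1+i

        ≥2+i⇒≢ : ∀ {w} → suc (suc i) ≤ toℕ w → w ≢ u × w ≢ v
        ≥2+i⇒≢ 2+i≤w = (λ { refl → <-irrefl (sym toℕ-u) (<⇒≤ 2+i≤w) })
                     , (λ { refl → <-irrefl (sym toℕ-v) 2+i≤w })

        after-≥ : All (λ w → suc (suc i) ≤ toℕ w) after
        after-≥ = nds-≥ (suc (suc i)) rest (≤-reflexive (cong suc 1+i+rest≡M))

      -- The two ends of a tree edge are consecutive in the preorder, so the survivors form one
      -- infix of it.
      cluster-preorder : ∀ {P} (P? : Decidable P) → P u → P v → (∀ {w} → w ≢ u × w ≢ v → ¬ P w) →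
                         filter P? (nds 0 (suc M)) ≡ u ∷ v ∷ []
      cluster-preorder P? pu pv ¬p = begin
        filter P? (nds 0 (suc M))
          ≡⟨ cong (filter P? ∘ nds 0) (trans (+-suc i (suc rest)) 1+i+1+rest≡1+M) ⟨
        filter P? (nds 0 (i + suc (suc rest)))
          ≡⟨ cong (filter P?) (nds-++ 0 i (suc (suc rest))) ⟩
        filter P? (nds 0 i ++ (u ∷ v ∷ []) ++ after)
          ≡⟨ filter-infix P? (u ∷ v ∷ []) (All.map (¬p ∘ <i⇒≢) (nds-< 0 i i≤1+M))
               (All.map (¬p ∘ ≥2+i⇒≢) after-≥) ⟩
        filter P? (u ∷ v ∷ [])
          ≡⟨ filter-all P? (pu ∷ pv ∷ []) ⟩
        u ∷ v ∷ [] ∎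
        where open ≡-Reasoning

      localPreorder-v : localPreorder G C x v ≡ 2
      localPreorder-v = trans
        (cong (λ vs → 1 + length (takeWhile (λ w → ¬? (w Fin.≟ v)) vs))
          (cluster-preorder (_∈? clusterNodes G C x) (here refl) (there (here refl)) ∉cluster))
        prefix
        where
        ∉cluster : ∀ {w} → w ≢ u × w ≢ v → w ∉ clusterNodes G C x
        ∉cluster (w≢u , w≢v) (here w≡u)         = w≢u w≡u
        ∉cluster (w≢u , w≢v) (there (here w≡v)) = w≢v w≡v
        prefix : 1 + length (takeWhile (λ w → ¬? (w Fin.≟ v)) (u ∷ v ∷ [])) ≡ 2
        -- The equality test does not compute on the open terms `u` and `v`, so both of its outcomes
        -- are supplied by rewriting.
        prefix rewrite dec-false (u Fin.≟ v) u≢v | dec-true (v Fin.≟ v) refl = refl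

      ¬storedAt-outEdges : ∀ {ws} → All (_≢ v) ws → All (¬_ ∘ StoredAt G C x) (concatMap outEdges ws)
      ¬storedAt-outEdges []                    = []
      ¬storedAt-outEdges (_∷_ {w} w≢v ws≢v) =
        (w≢v ∘ sym) ∷ 1-edge-≢ (next w) ∷ ¬storedAt-outEdges ws≢v
        where
        1-edge-≢ : ∀ y → ¬ StoredAt G C x (w , 1-edge , y)
        1-edge-≢ (terminal _) = w≢v ∘ sym

      -- A leaf stores only edges that leave the lower end `v` for a terminal.
      storedEdges-leaf : storedEdges G C belowRoot x ≡ (v , 0-edge , terminal bot) ∷ []
      storedEdges-leaf = trans
        (cong (λ es → filter (storedAt? G C x) (filter isComplement? es)) split)
        (filter-filter-singleton (storedAt? G C x) isComplement? (concatMap outEdges (nds 0 (suc i)))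
          refl (0-edge-complement v)
          (¬storedAt-outEdges (All.map <1+i⇒≢ (nds-< 0 (suc i) (≤-trans (<⇒≤ 1+i<M) (n≤1+n M)))))
          (¬storedAt-branch ∷ ¬storedAt-outEdges (All.map (proj₂ ∘ ≥2+i⇒≢) after-≥)))
        where
        split : concatMap outEdges (nds 0 (suc M)) ≡
                concatMap outEdges (nds 0 (suc i)) ++ concatMap outEdges (v ∷ after)
        split = begin
          concatMap outEdges (nds 0 (suc M))
            ≡⟨ cong (concatMap outEdges ∘ nds 0) 1+i+1+rest≡1+M ⟨
          concatMap outEdges (nds 0 (suc i + suc rest))
            ≡⟨ cong (concatMap outEdges) (nds-++ 0 (suc i) (suc rest)) ⟩
          concatMap outEdges (nds 0 (suc i) ++ v ∷ after)
            ≡⟨ concatMap-++ outEdges (nds 0 (suc i)) (v ∷ after) ⟩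
          concatMap outEdges (nds 0 (suc i)) ++ concatMap outEdges (v ∷ after) ∎
          where open ≡-Reasoning
        -- As `v` is not the last node, its 1-edge leads to a branching node.
        ¬storedAt-branch : ¬ StoredAt G C x (v , 1-edge , next v)
        ¬storedAt-branch rewrite next-nd 1+i<M = λ ()

      -- Neither the label difference -1 nor the local preorder 2 depends on `i`, so DAG compression
      -- identifies all these leaves.
      labelled-leaf : labelled G C belowRoot x ≡ leaf (1-edge , -[1+ 0 ]) ((2 , 0-edge , inj₁ bot) ∷ [])
      labelled-leaf = cong₂ (λ d ts → leaf (1-edge , d) ts)
        (trans (cong₂ (λ a b → suc a ⊖ suc b) toℕ-u toℕ-v)
          (trans (ℤ.[1+m]⊖[1+n]≡m⊖n i (suc i)) (i⊖1+i i)))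
        (trans (cong (map (triple G C x)) storedEdges-leaf)
          (cong (λ p → (p , 0-edge , inj₁ bot) ∷ []) localPreorder-v))
        where
        i⊖1+i : ∀ i → i ⊖ suc i ≡ -[1+ 0 ]
        i⊖1+i zero    = refl
        i⊖1+i (suc i) = trans (ℤ.[1+m]⊖[1+n]≡m⊖n i (suc i)) (i⊖1+i i)

    -- The label tree of every block of height h that does not contain the last edge.
    generic : ℕ → Labelled
    generic zero    = leaf (1-edge , -[1+ 0 ]) ((2 , 0-edge , inj₁ bot) ∷ [])
    generic (suc h) = merge V [] (generic h) (generic h)

    -- R is the number of blocks of height h.
    labelled-block : ∀ h {b R} → R * 2 ^ h ≡ M → suc b < R →
                     labelled G C belowRoot (block arcAt h b) ≡ generic h
    labelled-block zero    {b} {R} R≡M b<R =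
      labelled-leaf (subst (suc b <_) (trans (sym (*-identityʳ R)) R≡M) b<R)
    labelled-block (suc h) {b} {R} R≡M b<R
      rewrite storedEdges-merge V (block arcAt h (b * 2)) (block arcAt h (suc (b * 2)))
            -- Doubling `b<R` gives `4 + b * 2 ≤ R * 2`. The left half asks for 2 in place of 4 and
            -- the right half for 3, hence two weakenings and then one.
            | labelled-block h {b * 2} (halve R h R≡M) (<⇒≤ (<⇒≤ (*-monoˡ-≤ 2 b<R)))
            | labelled-block h {suc (b * 2)} (halve R h R≡M) (<⇒≤ (*-monoˡ-≤ 2 b<R)) = refl

    -- Counting the distinct labels.

    labels : ℕ → ℕ → List Labelled
    labels h b = map proj₁ (subtrees G C belowRoot (block arcAt h b))

    -- The labels below the b-th block of height h, when it is the last one.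
    candidates : ℕ → ℕ → List Labelled
    candidates zero    b = generic zero ∷ labelled G C belowRoot (block arcAt zero b) ∷ []
    candidates (suc h) b =
      generic (suc h) ∷ labelled G C belowRoot (block arcAt (suc h) b) ∷ candidates h (suc (b * 2))

    length-candidates : ∀ h b → length (candidates h b) ≡ suc h * 2
    length-candidates zero    b = refl
    length-candidates (suc h) b = cong (2 +_) (length-candidates h (suc (b * 2)))

    -- All blocks inside a block that is not the last are again not last, so they contribute one
    -- generic label per height. These occur in `candidates h b′` for every `b′`.
    labels-generic : ∀ h {b R} b′ → R * 2 ^ h ≡ M → suc b < R → All (_∈ candidates h b′) (labels h b)
    labels-generic zero    {R = R} b′ R≡M b<R = here (labelled-block zero R≡M b<R) ∷ []
    labels-generic (suc h) {b} {R} b′ R≡M b<R =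
      here (labelled-block (suc h) R≡M b<R) ∷
      All-map-++⁺ (subtrees G C belowRoot (block arcAt h (b * 2)))
        (∈-weaken₂ (labels-generic h _ (halve R h R≡M) (<⇒≤ (<⇒≤ (*-monoˡ-≤ 2 b<R)))))
        (∈-weaken₂ (labels-generic h _ (halve R h R≡M) (<⇒≤ (*-monoˡ-≤ 2 b<R))))

    -- Only the right half of the last block is again last; the left half is generic. The label of
    -- the last block never has to be computed, as it is itself a candidate.
    labels-last : ∀ h b → suc b * 2 ^ h ≡ M → All (_∈ candidates h b) (labels h b)
    labels-last zero    b b≡M = there (here refl) ∷ []
    labels-last (suc h) b b≡M =
      there (here refl) ∷
      All-map-++⁺ (subtrees G C belowRoot (block arcAt h (b * 2)))
        (∈-weaken₂ (labels-generic h _ (halve (suc b) h b≡M) ≤-refl))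
        (∈-weaken₂ (labels-last h (suc (b * 2)) (halve (suc b) h b≡M)))

  -- The size of the top DAG.

  module _ {k} (M≡2^1+k : M ≡ 2 ^ suc k) where

    construction : Construction G
    construction = C (block arcAt (suc k) 0)
      (subst (_⇓ block arcAt (suc k) 0) (sym (mapTree-arcs 0 M))
        (subst₂ (λ n h → chain (blocks arcAt 0 0 n) ⇓ block arcAt h 0) (sym M≡2^1+k) (+-identityʳ (suc k))
          (blocks-⇓ arcAt 0 (suc k))))

    size-≤ : TopZDD.size (topZDD G construction) ≤ suc (suc k * 2)
    size-≤ = ≤-trans
      (length-deduplicate-≤ _≟ᴸ_
        -- The root also stores the complement edges leaving the root of the tree, so its label is
        -- counted separately. Its halves are the blocks 0 and 1 of height `k`, out of `R = 2`.
        {ys = labelled G construction atRoot (block arcAt (suc k) 0) ∷ candidates _ _ k 1}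
        (here refl ∷ All.map there (All-map-++⁺ (subtrees G construction belowRoot (block arcAt k 0))
          (labels-generic _ _ k 1 2*2^k≡M ≤-refl)
          (labels-last _ _ k 1 2*2^k≡M))))
      (≤-reflexive (cong suc (length-candidates _ _ k 1)))
      where 2*2^k≡M = sym M≡2^1+k

theorem6 : ∃[ K ] (0 < K ×
    (∀ (N : ℕ) → ∃[ n ] (N < n ×
    (∃[ G ] (ZDD.nodes G ≡ n ×
    (∃[ C ] (TopZDD.size (topZDD G C) ≤ K * ⌊log₂ n ⌋)))))))
-- Take `M = 2 ^ suc N`, which gives `M + 1` branching nodes and two terminals. The bound is
-- `1 + 2 * suc N`; the factor 3 absorbs the extra 1, and `n ≥ 2 ^ suc N` bounds the logarithm below
-- by `suc N`.
theorem6 = 3 , z<s , λ N →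
  suc (2 ^ suc N) + 2 , N<n N , G (2 ^ suc N) (m^n>0 2 (suc N)) , refl ,
  construction (2 ^ suc N) (m^n>0 2 (suc N)) {N} refl , (begin
    TopZDD.size (topZDD _ (construction (2 ^ suc N) (m^n>0 2 (suc N)) {N} refl))
      ≤⟨ size-≤ (2 ^ suc N) (m^n>0 2 (suc N)) {N} refl ⟩
    suc (suc N * 2)                     ≤⟨ s≤s (m≤n+m (suc N * 2) N) ⟩
    suc N + suc N * 2                   ≡⟨ *-suc (suc N) 2 ⟨
    suc N * 3                           ≡⟨ *-comm (suc N) 3 ⟩
    3 * suc N                           ≡⟨ cong (3 *_) (⌊log₂[2^n]⌋≡n (suc N)) ⟨
    3 * ⌊log₂ 2 ^ suc N ⌋               ≤⟨ *-monoʳ-≤ 3 (⌊log₂⌋-mono-≤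
                                               (≤-trans (n≤1+n (2 ^ suc N)) (m≤m+n (suc (2 ^ suc N)) 2))) ⟩
    3 * ⌊log₂ (suc (2 ^ suc N) + 2) ⌋   ∎)
  where
  open PathZDD
  open ≤-Reasoning
  n<2^n : ∀ n → n < 2 ^ n
  n<2^n zero    = z<s
  n<2^n (suc n) = +-mono-≤ (m^n>0 2 n) (≤-trans (n<2^n n) (m≤m+n (2 ^ n) 0))
  N<n : ∀ N → N < suc (2 ^ suc N) + 2
  N<n N = ≤-trans (n<2^n N) (≤-trans (≤-trans (m≤m+n (2 ^ N) _) (n≤1+n _)) (m≤m+n _ 2))
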